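{- (i) For every $f \in \mathcal{G}$ there are $g \in \mathcal{G}$ and a recursive injective function $j:\mathbb{N}\to\mathbb{N}$ such that for all $x,y$: $x \equiv_f y \iff |[j\langle x,y\rangle]_g| < \infty$. (ii) For every $g \in \mathcal{G}$ there are $f \in \mathcal{G}$ and two recursive injective functions $j, j':\mathbb{N}\to\mathbb{N}$ such that for all $x$: $|[x]_g| < \infty \iff j(x) \equiv_f j'(x)$.
   Context: $\mathcal{G}$ is the group of recursive permutations of $\mathbb{N}$; $[x]_f = \{f^k(x):k\in\mathbb{Z}\}$ and $x\equiv_f y$ means $y\in[x]_f$; $\langle\cdot,\cdot\rangle$ is a recursive pairing bijection $\mathbb{N}^2\to\mathbb{N}$. -}

module Defs where

open import Data.Nat using (ℕ; zero; suc)
open import Data.Integer using (ℤ; +_; -[1+_])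
open import Data.Product using (Σ; ∃; _×_; _,_)
open import Data.List using (List)
open import Data.List.Membership.Propositional using (_∈_)
open import Function.Base using (_∘_)
open import Function.Bundles using (_↔_; Inverse)
open import Relation.Binary.PropositionalEquality using (_≡_)

-- Recursive permutations of ℕ: Agda functions are computable, so a
-- permutation of ℕ is a bijection with (computable) inverse.
Perm : Set
Perm = ℕ ↔ ℕ

iter : (ℕ → ℕ) → ℕ → ℕ → ℕ
iter h zero    x = x
iter h (suc n) x = h (iter h n x)

pow : Perm → ℤ → ℕ → ℕ
pow f (+ n)     = iter (Inverse.to f) n
pow f -[1+ n ]  = iter (Inverse.from f) (suc n)

_≡[_]_ : ℕ → Perm → ℕ → Set
x ≡[ f ] y = ∃ λ (k : ℤ) → pow f k x ≡ y

FiniteOrbit : Perm → ℕ → Set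
FiniteOrbit g x = Σ (List ℕ) λ L → ∀ y → x ≡[ g ] y → y ∈ L

-- Both reductions rest on one fact: x has a finite g-orbit iff it is periodic,
-- g^(p+1) x = x for some p. A permutation of ℕ is assembled fibrewise, acting on
-- the fibre {c} × (ℕ ⊎ ℕ) of a fixed coding ℕ × (ℕ ⊎ ℕ) ↔ ℕ.
-- (i) On the fibre of c = ⟨x,y⟩ a "ladder" climbs from rung 0 until the first n
-- with f^n x = y or f^(-n-1) x = y, then crosses and climbs back down, so it is
-- periodic iff x ≡_f y. Deciding the rungs is where recursiveness of f is used.
-- (ii) On the fibre of x two copies of g are glued at x: starting at x in the
-- first copy, one crosses into the second copy exactly when the g-orbit of x
-- returns to x, so the two copies of x are linked iff x is g-periodic.
module Submission where

open import Defs
open import Data.Nat using (ℕ; zero; suc; _+_; _*_; _<_; _≤_; s≤s⁻¹)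
open import Data.Nat.Properties
open import Data.Nat.GeneralisedArithmetic using (fold; fold-+; iterate-is-fold)
open import Data.Nat.DivMod using (_%_; _/_; m≡m%n+[m/n]*n; m%n<n)
open import Data.Integer using (+_; -[1+_])
open import Data.Fin using (toℕ)
import Data.Fin.Properties as Fin
open import Data.Product using (Σ; ∃; _×_; _,_; proj₁; proj₂; uncurry)
open import Data.Product.Function.NonDependent.Propositional using (_×-↔_)
open import Data.Sum as Sum using (_⊎_; inj₁; inj₂; reduce; swap)
open import Data.Sum.Function.Propositional using (_⊎-↔_)
open import Data.List using (List; length; applyUpTo; lookup)
open import Data.List.Membership.Propositional using (_∈_)
open import Data.List.Membership.Propositional.Properties using (∈-applyUpTo⁺)
open import Data.List.Relation.Unary.Any using (index)
open import Data.List.Relation.Unary.Any.Properties using (lookup-index)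
open import Function.Base using (_∘_)
open import Function.Bundles using (_↔_; _⇔_; Inverse; Injection; mk⇔; mk↔ₛ′)
open import Function.Construct.Composition using (_↔-∘_; _⇔-∘_)
open import Function.Construct.Identity using (↔-id)
open import Function.Construct.Symmetry using (↔-sym; ⇔-sym)
open import Function.Definitions using (Injective)
open import Function.Properties.Inverse using (↔⇒↣)
open import Relation.Nullary using (¬_; yes; no; contradiction)
open import Relation.Nullary.Decidable using (_⊎-dec_)
open import Relation.Unary using (Decidable)
open import Relation.Binary.PropositionalEquality

open Inverse using (to; from)

private variable
  A B : Set

iter≗fold : ∀ h n (x : ℕ) → iter h n x ≡ fold x h n
iter≗fold h zero    x = refl
iter≗fold h (suc n) x = cong h (iter≗fold h n x)

fold-sucˡ : ∀ (z : A) h n → fold z h (suc n) ≡ fold (h z) h n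
fold-sucˡ z h n = trans (iterate-is-fold z h (suc n)) (sym (iterate-is-fold (h z) h n))

fold-from-to : (e : A ↔ A) → ∀ n z → fold (fold z (to e) n) (from e) n ≡ z
fold-from-to e zero    z = refl
fold-from-to e (suc n) z = begin
  fold (to e (fold z (to e) n)) (from e) (suc n)    ≡⟨ fold-sucˡ _ (from e) n ⟩
  fold (from e (to e (fold z (to e) n))) (from e) n ≡⟨ cong (λ w → fold w (from e) n)
                                                         (Inverse.strictlyInverseʳ e _) ⟩
  fold (fold z (to e) n) (from e) n                 ≡⟨ fold-from-to e n z ⟩
  z                                                 ∎
  where open ≡-Reasoning

fold-injective : (e : A ↔ A) → ∀ n → Injective _≡_ _≡_ (λ a → fold a (to e) n)
fold-injective e n {a} {b} eq = begin
  a                                         ≡⟨ fold-from-to e n a ⟨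
  fold (fold a (to e) n) (from e) n         ≡⟨ cong (λ w → fold w (from e) n) eq ⟩
  fold (fold b (to e) n) (from e) n         ≡⟨ fold-from-to e n b ⟩
  b                                         ∎
  where open ≡-Reasoning

record Semiconjugacy (π : A → B) (h : A → A) (g : B → B) : Set where
  constructor semiconjugacy
  field commutes : ∀ a → π (h a) ≡ g (π a)

fold-semiconj : {π : A → B} {h : A → A} {g : B → B} →
                Semiconjugacy π h g → ∀ n a → π (fold a h n) ≡ fold (π a) g n
fold-semiconj         _                       zero    a = refl
fold-semiconj {g = g} s@(semiconjugacy πh≡gπ) (suc n) a =
  trans (πh≡gπ _) (cong g (fold-semiconj s n a))

Periodic : (A → A) → A → Set
Periodic h a = ∃ λ p → fold a h (suc p) ≡ a

periodic-semiconj : {π : A → B} {h : A → A} {g : B → B} →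
                    Injective _≡_ _≡_ π → Semiconjugacy π h g →
                    ∀ a → Periodic g (π a) ⇔ Periodic h a
periodic-semiconj {π = π} π-injective πh≡gπ a = mk⇔
  (λ (p , per) → p , π-injective (trans (fold-semiconj πh≡gπ (suc p) a) per))
  (λ (p , per) → p , trans (sym (fold-semiconj πh≡gπ (suc p) a)) (cong π per))

fold-multiple : ∀ {h : A → A} {a p} → fold a h (suc p) ≡ a → ∀ k → fold a h (k * suc p) ≡ a
fold-multiple         per zero    = refl
fold-multiple {h = h} {a} {p} per (suc k) = begin
  fold a h (suc p + k * suc p)          ≡⟨ fold-+ a h (suc p) ⟩
  fold (fold a h (k * suc p)) h (suc p) ≡⟨ cong (λ w → fold w h (suc p)) (fold-multiple per k) ⟩
  fold a h (suc p)                      ≡⟨ per ⟩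
  a                                     ∎
  where open ≡-Reasoning

fold-mod : ∀ {h : A → A} {a p} → fold a h (suc p) ≡ a → ∀ m → fold a h m ≡ fold a h (m % suc p)
fold-mod {h = h} {a} {p} per m = begin
  fold a h m                                        ≡⟨ cong (fold a h) (m≡m%n+[m/n]*n m (suc p)) ⟩
  fold a h (m % suc p + m / suc p * suc p)          ≡⟨ fold-+ a h (m % suc p) ⟩
  fold (fold a h (m / suc p * suc p)) h (m % suc p) ≡⟨ cong (λ w → fold w h (m % suc p))
                                                         (fold-multiple per (m / suc p)) ⟩
  fold a h (m % suc p)                              ∎
  where open ≡-Reasoning

Minimal : (ℕ → Set) → ℕ → Set
Minimal P m = P m × (∀ {i} → i < m → ¬ P i)

minimal-or-none : {P : ℕ → Set} → Decidable P → ∀ n → ∃ (Minimal P) ⊎ (∀ {i} → i < n → ¬ P i)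
minimal-or-none P? zero = inj₂ λ ()
minimal-or-none P? (suc n) with minimal-or-none P? n
... | inj₁ m = inj₁ m
... | inj₂ none with P? n
...   | yes pn = inj₁ (n , pn , none)
...   | no ¬pn = inj₂ λ i<1+n → Sum.[ none , (λ { refl → ¬pn }) ] (m<1+n⇒m<n∨m≡n i<1+n)

minimal : {P : ℕ → Set} → Decidable P → ∀ {n} → P n → ∃ (Minimal P)
minimal P? {n} pn with minimal-or-none P? (suc n)
... | inj₁ m    = m
... | inj₂ none = contradiction pn (none ≤-refl)

minimal-period : ∀ h {x} → Periodic h x → ∃ (Minimal λ p → fold x h (suc p) ≡ x)
minimal-period h {x} (p , per) =
  minimal {λ p → fold x h (suc p) ≡ x} (λ p → fold x h (suc p) ≟ x) {p} per

≡[]⇒fold : ∀ {g x y} → x ≡[ g ] y → ∃ λ n → fold x (to g) n ≡ y ⊎ fold y (to g) n ≡ x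
≡[]⇒fold {g} {x} (+ n , eq) = n , inj₁ (trans (sym (iter≗fold (to g) n x)) eq)
≡[]⇒fold {g} {x} {y} (-[1+ n ] , eq) = suc n , inj₂ (begin
  fold y (to g) (suc n)                         ≡⟨ cong (λ w → fold w (to g) (suc n))
                                                      (trans (sym eq) (iter≗fold (from g) (suc n) x)) ⟩
  fold (fold x (from g) (suc n)) (to g) (suc n) ≡⟨ fold-from-to (↔-sym g) (suc n) x ⟩
  x                                             ∎)
  where open ≡-Reasoning

fold⇒≡[] : ∀ {g x y} n → fold x (to g) n ≡ y → x ≡[ g ] y
fold⇒≡[] {g} {x} n eq = + n , trans (iter≗fold (to g) n x) eq

list-pigeonhole : (s : ℕ → A) (L : List A) → (∀ {i} → i ≤ length L → s i ∈ L) →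
                  ∃ λ i → ∃ λ j → i < j × s i ≡ s j
list-pigeonhole s L s∈L
  with i , j , i<j , eq ← Fin.pigeonhole (n<1+n (length L)) (λ i → index (s∈L (s≤s⁻¹ (Fin.toℕ<n i))))
  = toℕ i , toℕ j , i<j ,
    trans (lookup-index (s∈L _)) (trans (cong (lookup L) eq) (sym (lookup-index (s∈L _))))

module _ (g : Perm) where

  finiteOrbit⇒periodic : ∀ {x} → FiniteOrbit g x → Periodic (to g) x
  finiteOrbit⇒periodic {x} (L , orbit⊆L)
    with i , j , i<j , eq ← list-pigeonhole (fold x (to g)) L (λ {i} _ → orbit⊆L _ (fold⇒≡[] i refl))
    with o , i+o≡j ← m≤n⇒∃[o]m+o≡n i<j
    = o , fold-injective g i (begin
      fold (fold x (to g) (suc o)) (to g) i ≡⟨ fold-+ x (to g) i ⟨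
      fold x (to g) (i + suc o)             ≡⟨ cong (fold x (to g)) (trans (+-suc i o) i+o≡j) ⟩
      fold x (to g) j                       ≡⟨ eq ⟨
      fold x (to g) i                       ∎)
    where open ≡-Reasoning

  periodic⇒finiteOrbit : ∀ {x} → Periodic (to g) x → FiniteOrbit g x
  periodic⇒finiteOrbit {x} (p , per) = firstPeriod , λ y x≡y → in-firstPeriod y (≡[]⇒fold x≡y)
    where
    firstPeriod : List ℕ
    firstPeriod = applyUpTo (fold x (to g)) (suc p)

    forward-in-firstPeriod : ∀ n → fold x (to g) n ∈ firstPeriod
    forward-in-firstPeriod n =
      subst (_∈ firstPeriod) (sym (fold-mod per n)) (∈-applyUpTo⁺ (fold x (to g)) (m%n<n n (suc p)))

    in-firstPeriod : ∀ y → ∃ (λ n → fold x (to g) n ≡ y ⊎ fold y (to g) n ≡ x) → y ∈ firstPeriod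
    in-firstPeriod y (n , inj₁ eq) = subst (_∈ firstPeriod) eq (forward-in-firstPeriod n)
    in-firstPeriod y (n , inj₂ eq) = subst (_∈ firstPeriod) backward (forward-in-firstPeriod (n * p))
      where
      open ≡-Reasoning
      backward : fold x (to g) (n * p) ≡ y
      backward = fold-injective g n (begin
        fold (fold x (to g) (n * p)) (to g) n ≡⟨ fold-+ x (to g) n ⟨
        fold x (to g) (n + n * p)             ≡⟨ cong (fold x (to g)) (*-suc n p) ⟨
        fold x (to g) (n * suc p)             ≡⟨ fold-multiple per n ⟩
        x                                     ≡⟨ eq ⟨
        fold y (to g) n                       ∎)

  finiteOrbit⇔periodic : ∀ x → FiniteOrbit g x ⇔ Periodic (to g) x
  finiteOrbit⇔periodic x = mk⇔ finiteOrbit⇒periodic periodic⇒finiteOrbit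

ℕ⊎ℕ↔ℕ : (ℕ ⊎ ℕ) ↔ ℕ
ℕ⊎ℕ↔ℕ = mk↔ₛ′ interleave deinterleave interleave-deinterleave deinterleave-interleave
  where
  interleave : ℕ ⊎ ℕ → ℕ
  interleave (inj₁ n) = 2 * n
  interleave (inj₂ n) = suc (2 * n)

  deinterleave : ℕ → ℕ ⊎ ℕ
  deinterleave zero          = inj₁ zero
  deinterleave (suc zero)    = inj₂ zero
  deinterleave (suc (suc m)) = Sum.map suc suc (deinterleave m)

  interleave-map-suc : ∀ s → interleave (Sum.map suc suc s) ≡ suc (suc (interleave s))
  interleave-map-suc (inj₁ n) = cong suc (+-suc n (n + 0))
  interleave-map-suc (inj₂ n) = cong (suc ∘ suc) (+-suc n (n + 0))

  interleave-deinterleave : ∀ m → interleave (deinterleave m) ≡ m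
  interleave-deinterleave zero          = refl
  interleave-deinterleave (suc zero)    = refl
  interleave-deinterleave (suc (suc m)) =
    trans (interleave-map-suc (deinterleave m)) (cong (suc ∘ suc) (interleave-deinterleave m))

  deinterleave-interleave : ∀ s → deinterleave (interleave s) ≡ s
  deinterleave-interleave (inj₁ zero)    = refl
  deinterleave-interleave (inj₂ zero)    = refl
  deinterleave-interleave (inj₁ (suc n)) = trans (cong deinterleave (interleave-map-suc (inj₁ n)))
                                                 (cong (Sum.map suc suc) (deinterleave-interleave (inj₁ n)))
  deinterleave-interleave (inj₂ (suc n)) = trans (cong deinterleave (interleave-map-suc (inj₂ n)))
                                                 (cong (Sum.map suc suc) (deinterleave-interleave (inj₂ n)))

fibrewise : {I : Set} → (I → B ↔ B) → (I × B) ↔ (I × B)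
fibrewise h = mk↔ₛ′ (λ (c , b) → c , to (h c) b) (λ (c , b) → c , from (h c) b)
  (λ (c , b) → cong (c ,_) (Inverse.strictlyInverseˡ (h c) b))
  (λ (c , b) → cong (c ,_) (Inverse.strictlyInverseʳ (h c) b))

module Assembly (pair : (ℕ × ℕ) ↔ ℕ) where

  code : (ℕ × (ℕ ⊎ ℕ)) ↔ ℕ
  code = pair ↔-∘ (↔-id ℕ ×-↔ ℕ⊎ℕ↔ℕ)

  assemble : (ℕ → (ℕ ⊎ ℕ) ↔ (ℕ ⊎ ℕ)) → Perm
  assemble h = code ↔-∘ (fibrewise h ↔-∘ ↔-sym code)

  code-injective : Injective _≡_ _≡_ (to code)
  code-injective = Injection.injective (↔⇒↣ code)

  code-injectiveˡ : ∀ (b : ℕ → ℕ ⊎ ℕ) → Injective _≡_ _≡_ (λ c → to code (c , b c))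
  code-injectiveˡ b {x} {y} eq = cong proj₁ (code-injective {x , b x} {y , b y} eq)

  module _ (h : ℕ → (ℕ ⊎ ℕ) ↔ (ℕ ⊎ ℕ)) (c : ℕ) where

    code-injectiveʳ : Injective _≡_ _≡_ (λ b → to code (c , b))
    code-injectiveʳ = cong proj₂ ∘ code-injective

    code-semiconj : Semiconjugacy (λ b → to code (c , b)) (to (h c)) (to (assemble h))
    code-semiconj = semiconjugacy λ b →
      cong (to code ∘ to (fibrewise h)) (sym (Inverse.strictlyInverseʳ code (c , b)))

    finiteOrbit-assemble⇔periodic : ∀ b → FiniteOrbit (assemble h) (to code (c , b)) ⇔ Periodic (to (h c)) b
    finiteOrbit-assemble⇔periodic b =
      periodic-semiconj code-injectiveʳ code-semiconj b ⇔-∘ finiteOrbit⇔periodic (assemble h) _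

    ≡[assemble]⇒fold : ∀ {b b′} → to code (c , b) ≡[ assemble h ] to code (c , b′) →
                       ∃ λ n → fold b (to (h c)) n ≡ b′ ⊎ fold b′ (to (h c)) n ≡ b
    ≡[assemble]⇒fold orbit with n , reach ← ≡[]⇒fold orbit =
      n , Sum.map (descend _ _) (descend _ _) reach
      where
      descend : ∀ b b′ → fold (to code (c , b)) (to (assemble h)) n ≡ to code (c , b′) →
                fold b (to (h c)) n ≡ b′
      descend b b′ eq = code-injectiveʳ (trans (fold-semiconj code-semiconj n b) eq)

    fold⇒≡[assemble] : ∀ {b b′} n → fold b (to (h c)) n ≡ b′ →
                       to code (c , b) ≡[ assemble h ] to code (c , b′)
    fold⇒≡[assemble] {b} n eq =
      fold⇒≡[] n (trans (sym (fold-semiconj code-semiconj n b)) (cong (λ b → to code (c , b)) eq))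

-- inj₁ n and inj₂ n are the n-th rungs of an ascending and a descending rail,
-- joined at rung n exactly when P n, and at the bottom.
module Ladder {P : ℕ → Set} (P? : Decidable P) where

  step : ℕ ⊎ ℕ → ℕ ⊎ ℕ
  step (inj₁ n) with P? n
  ... | yes _ = inj₂ n
  ... | no  _ = inj₁ (suc n)
  step (inj₂ zero) = inj₁ zero
  step (inj₂ (suc n)) with P? n
  ... | yes _ = inj₁ (suc n)
  ... | no  _ = inj₂ n

  unstep : ℕ ⊎ ℕ → ℕ ⊎ ℕ
  unstep (inj₁ zero) = inj₂ zero
  unstep (inj₁ (suc n)) with P? n
  ... | yes _ = inj₂ (suc n)
  ... | no  _ = inj₁ n
  unstep (inj₂ n) with P? n
  ... | yes _ = inj₁ n
  ... | no  _ = inj₂ (suc n)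

  step-unstep : ∀ s → step (unstep s) ≡ s
  step-unstep (inj₁ zero) = refl
  step-unstep (inj₁ (suc n)) with P? n in eq
  ... | yes _ rewrite eq = refl
  ... | no  _ rewrite eq = refl
  step-unstep (inj₂ n) with P? n in eq
  ... | yes _ rewrite eq = refl
  ... | no  _ rewrite eq = refl

  unstep-step : ∀ s → unstep (step s) ≡ s
  unstep-step (inj₁ n) with P? n in eq
  ... | yes _ rewrite eq = refl
  ... | no  _ rewrite eq = refl
  unstep-step (inj₂ zero) = refl
  unstep-step (inj₂ (suc n)) with P? n in eq
  ... | yes _ rewrite eq = refl
  ... | no  _ rewrite eq = refl

  ladder : (ℕ ⊎ ℕ) ↔ (ℕ ⊎ ℕ)
  ladder = mk↔ₛ′ step unstep step-unstep unstep-step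

  step-up : ∀ {n} → ¬ P n → step (inj₁ n) ≡ inj₁ (suc n)
  step-up {n} ¬pn with P? n
  ... | yes pn = contradiction pn ¬pn
  ... | no  _  = refl

  step-across : ∀ {n} → P n → step (inj₁ n) ≡ inj₂ n
  step-across {n} pn with P? n
  ... | yes _   = refl
  ... | no  ¬pn = contradiction pn ¬pn

  step-down : ∀ {n} → ¬ P n → step (inj₂ (suc n)) ≡ inj₂ n
  step-down {n} ¬pn with P? n
  ... | yes pn = contradiction pn ¬pn
  ... | no  _  = refl

  climb : ∀ {n} → (∀ {i} → i < n → ¬ P i) → fold (inj₁ 0) step n ≡ inj₁ n
  climb {zero}  none = refl
  climb {suc n} none = trans (cong step (climb (none ∘ m<n⇒m<1+n))) (step-up (none ≤-refl))

  descend : ∀ {n} → (∀ {i} → i < n → ¬ P i) → fold (inj₂ n) step (suc n) ≡ inj₁ 0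
  descend {zero}  none = refl
  descend {suc n} none = begin
    fold (inj₂ (suc n)) step (suc (suc n))  ≡⟨ fold-sucˡ _ step (suc n) ⟩
    fold (step (inj₂ (suc n))) step (suc n) ≡⟨ cong (λ s → fold s step (suc n)) (step-down (none ≤-refl)) ⟩
    fold (inj₂ n) step (suc n)              ≡⟨ descend (none ∘ m<n⇒m<1+n) ⟩
    inj₁ 0                                  ∎
    where open ≡-Reasoning

  periodic⇔satisfiable : Periodic step (inj₁ 0) ⇔ ∃ P
  periodic⇔satisfiable = mk⇔ satisfiable periodic
    where
    satisfiable : Periodic step (inj₁ 0) → ∃ P
    satisfiable (p , per) with minimal-or-none P? (suc p)
    ... | inj₁ (m , pm , _) = m , pm
    ... | inj₂ none         = contradiction (trans (sym (climb none)) per) λ ()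

    periodic : ∃ P → Periodic step (inj₁ 0)
    periodic (_ , pn) with m , pm , below ← minimal P? pn = m + suc m , (begin
      fold (inj₁ 0) step (suc m + suc m)              ≡⟨ fold-+ (inj₁ 0) step (suc m) ⟩
      fold (step (fold (inj₁ 0) step m)) step (suc m) ≡⟨ cong (λ s → fold (step s) step (suc m)) (climb below) ⟩
      fold (step (inj₁ m)) step (suc m)               ≡⟨ cong (λ s → fold s step (suc m)) (step-across pm) ⟩
      fold (inj₂ m) step (suc m)                      ≡⟨ descend below ⟩
      inj₁ 0                                          ∎)
      where open ≡-Reasoning

module Switch (g : Perm) (x : ℕ) where

  swapAt : ℕ ⊎ ℕ → ℕ ⊎ ℕ
  swapAt s with reduce s ≟ x
  ... | yes _ = swap s
  ... | no  _ = s

  swapAt-involutive : ∀ s → swapAt (swapAt s) ≡ s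
  swapAt-involutive (inj₁ a) with a ≟ x in eq
  ... | yes _ rewrite eq = refl
  ... | no  _ rewrite eq = refl
  swapAt-involutive (inj₂ a) with a ≟ x in eq
  ... | yes _ rewrite eq = refl
  ... | no  _ rewrite eq = refl

  reduce-swapAt : ∀ s → reduce (swapAt s) ≡ reduce s
  reduce-swapAt (inj₁ a) with a ≟ x
  ... | yes _ = refl
  ... | no  _ = refl
  reduce-swapAt (inj₂ a) with a ≟ x
  ... | yes _ = refl
  ... | no  _ = refl

  swapAt-apart : ∀ {s} → reduce s ≢ x → swapAt s ≡ s
  swapAt-apart {s} s≢x with reduce s ≟ x
  ... | yes s≡x = contradiction s≡x s≢x
  ... | no  _   = refl

  swapAt-at : swapAt (inj₁ x) ≡ inj₂ x
  swapAt-at with x ≟ x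
  ... | yes _   = refl
  ... | no  x≢x = contradiction refl x≢x

  switch : (ℕ ⊎ ℕ) ↔ (ℕ ⊎ ℕ)
  switch = mk↔ₛ′ swapAt swapAt swapAt-involutive swapAt-involutive ↔-∘ (g ⊎-↔ g)

  reduce-semiconj : Semiconjugacy reduce (to switch) (to g)
  reduce-semiconj = semiconjugacy λ s → trans (reduce-swapAt (Sum.map (to g) (to g) s)) (reduce-map s)
    where
    reduce-map : ∀ s → reduce (Sum.map (to g) (to g) s) ≡ to g (reduce s)
    reduce-map (inj₁ a) = refl
    reduce-map (inj₂ a) = refl

  stay : ∀ {n} → (∀ {i} → i < n → fold x (to g) (suc i) ≢ x) →
         fold (inj₁ x) (to switch) n ≡ inj₁ (fold x (to g) n)
  stay {zero}  _     = refl
  stay {suc n} apart = trans (cong (to switch) (stay (apart ∘ m<n⇒m<1+n))) (swapAt-apart (apart ≤-refl))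

  first-return : ∀ {p} → Minimal (λ p → fold x (to g) (suc p) ≡ x) p →
                 fold (inj₁ x) (to switch) (suc p) ≡ inj₂ x
  first-return (back , apart) =
    trans (cong (to switch) (stay apart)) (trans (cong (λ y → swapAt (inj₁ y)) back) swapAt-at)

  path⇒periodic : ∀ {b b′} n → b ≢ b′ → reduce b ≡ x → reduce b′ ≡ x →
                  fold b (to switch) n ≡ b′ → Periodic (to g) x
  path⇒periodic          zero    b≢b′ _   _    path = contradiction path b≢b′
  path⇒periodic {b} {b′} (suc p) _    b↦x b′↦x path = p , (begin
    fold x (to g) (suc p)               ≡⟨ cong (λ y → fold y (to g) (suc p)) b↦x ⟨
    fold (reduce b) (to g) (suc p)      ≡⟨ fold-semiconj reduce-semiconj (suc p) b ⟨
    reduce (fold b (to switch) (suc p)) ≡⟨ cong reduce path ⟩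
    reduce b′                           ≡⟨ b′↦x ⟩
    x                                   ∎)
    where open ≡-Reasoning

Meets : Perm → ℕ × ℕ → ℕ → Set
Meets f (x , y) n = pow f (+ n) x ≡ y ⊎ pow f -[1+ n ] x ≡ y

meets? : ∀ f q → Decidable (Meets f q)
meets? f (x , y) n = (pow f (+ n) x ≟ y) ⊎-dec (pow f -[1+ n ] x ≟ y)

∃meets⇔≡[] : ∀ f q → ∃ (Meets f q) ⇔ uncurry _≡[ f ]_ q
∃meets⇔≡[] f (x , y) = mk⇔ (λ { (n , inj₁ eq) → + n , eq ; (n , inj₂ eq) → -[1+ n ] , eq })
                           (λ { (+ n , eq) → n , inj₁ eq ; (-[1+ n ] , eq) → n , inj₂ eq })

module _ (pair : (ℕ × ℕ) ↔ ℕ) where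
  open Assembly pair

  ≡[]-reduces-to-FiniteOrbit : (f : Perm) → Σ Perm λ g → Σ (ℕ → ℕ) λ j → Injective _≡_ _≡_ j
    × (∀ x y → (x ≡[ f ] y) ⇔ FiniteOrbit g (j (to pair (x , y))))
  ≡[]-reduces-to-FiniteOrbit f = G , j , code-injectiveˡ (λ _ → inj₁ 0) , λ x y →
      subst (λ q → uncurry _≡[ f ]_ q ⇔ FiniteOrbit G (j (to pair (x , y))))
            (Inverse.strictlyInverseʳ pair (x , y)) (⇔-sym (fibre⇔ (to pair (x , y))))
    where
    ladderAt : ℕ → (ℕ ⊎ ℕ) ↔ (ℕ ⊎ ℕ)
    ladderAt c = Ladder.ladder (meets? f (from pair c))

    G : Perm
    G = assemble ladderAt

    j : ℕ → ℕ
    j c = to code (c , inj₁ 0)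

    fibre⇔ : ∀ c → FiniteOrbit G (j c) ⇔ uncurry _≡[ f ]_ (from pair c)
    fibre⇔ c = ∃meets⇔≡[] f (from pair c)
           ⇔-∘ (Ladder.periodic⇔satisfiable (meets? f (from pair c))
           ⇔-∘ finiteOrbit-assemble⇔periodic ladderAt c (inj₁ 0))

  FiniteOrbit-reduces-to-≡[] : (g : Perm) → Σ Perm λ f → Σ (ℕ → ℕ) λ j → Σ (ℕ → ℕ) λ j′
    → Injective _≡_ _≡_ j × Injective _≡_ _≡_ j′ × (∀ x → FiniteOrbit g x ⇔ (j x ≡[ f ] j′ x))
  FiniteOrbit-reduces-to-≡[] g =
    F , j , j′ , code-injectiveˡ inj₁ , code-injectiveˡ inj₂ , λ x → mk⇔ (linked x) (finite x)
    where
    F : Perm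
    F = assemble (Switch.switch g)

    j j′ : ℕ → ℕ
    j  x = to code (x , inj₁ x)
    j′ x = to code (x , inj₂ x)

    linked : ∀ x → FiniteOrbit g x → j x ≡[ F ] j′ x
    linked x orbit with p , min ← minimal-period (to g) (finiteOrbit⇒periodic g orbit) =
      fold⇒≡[assemble] (Switch.switch g) x (suc p) (Switch.first-return g x min)

    finite : ∀ x → j x ≡[ F ] j′ x → FiniteOrbit g x
    finite x orbit with n , reach ← ≡[assemble]⇒fold (Switch.switch g) x {inj₁ x} {inj₂ x} orbit =
      periodic⇒finiteOrbit g
        (Sum.[ path⇒periodic n (λ ()) refl refl , path⇒periodic n (λ ()) refl refl ] reach)
      where open Switch g x using (path⇒periodic)

theorem4p13 : (pair : (ℕ × ℕ) ↔ ℕ)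
    → ((f : Perm) → Σ Perm λ g → Σ (ℕ → ℕ) λ j → Injective _≡_ _≡_ j
         × (∀ x y → (x ≡[ f ] y) ⇔ FiniteOrbit g (j (Inverse.to pair (x , y)))))
    × ((g : Perm) → Σ Perm λ f → Σ (ℕ → ℕ) λ j → Σ (ℕ → ℕ) λ j′
         → Injective _≡_ _≡_ j × Injective _≡_ _≡_ j′
         × (∀ x → FiniteOrbit g x ⇔ (j x ≡[ f ] j′ x)))
theorem4p13 pair = ≡[]-reduces-to-FiniteOrbit pair , FiniteOrbit-reduces-to-≡[] pair
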